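{- Let $G=(V,E,\phi)$ be a road network, let $T$ be a stable tree hierarchy over $G$, and let $L$ be the stable tree labelling over $T$. For any vertices $s,t\in V(G)$ there exists at least one vertex $r\in \mathrm{Anc}(s)\cap \mathrm{Anc}(t)$ and distance entries $\delta_{sr}\in L(s)$ and $\delta_{tr}\in L(t)$ such that $\delta_{sr}+\delta_{tr}=d_G(s,t)$.
   Context: A road network is a finite undirected graph $G=(V,E,\phi)$ with edge weights $\phi(u,v)\in\mathbb{R}_{\ge 0}$. A path is a sequence of vertices $(v_1,\dots,v_k)$ with $(v_i,v_{i+1})\in E$; its weight is $\sum_{i=1}^{k-1}\phi(v_i,v_{i+1})$. A shortest path between $s$ and $t$ is a path between them of minimal weight; $d_G(s,t)$ is that weight ($\infty$ if no path exists), and $P_G(s,t)$ is the set of all shortest paths between $s$ and $t$ in $G$. $V(p)$ is the set of vertices of a path $p$. A stable tree hierarchy over $G$ is a rooted binary tree $T=(\mathcal{N},\mathcal{E},\ell)$, where $\mathcal{N}$ is a set of tree nodes, $\mathcal{E}$ a set of tree edges, and $\ell:V(G)\to\mathcal{N}$ a total surjective function, such that: (1) for a constant $0<\beta\le 0.5$, each $N\in\mathcal{N}$ with left and right children $N_l,N_r$ satisfies $|T_\downarrow(N_l)|,|T_\downarrow(N_r)|\le(1-\beta)\,|T_\downarrow(N)|$, where $T_\downarrow(N)$ is the subtree rooted at $N$ (its size being the number of vertices of $G$ mapped by $\ell$ into it); (2) for any two vertices $s,t\in V(G)$ and every $p\in P_G(s,t)$, $V(p)\cap \mathrm{Ca}(s,t)\ne\emptyset$,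 where $\mathrm{Ca}(s,t)$ is the set of vertices mapped by $\ell$ to common ancestors of $\ell(s)$ and $\ell(t)$ in $T$ (a node counts as an ancestor of itself). Vertex partial order: fix an arbitrary total order $\preceq_t$ on $V$. Then $w\preceq v$ iff $\ell(w)$ is a strict ancestor of $\ell(v)$ in $T$, or $\ell(w)=\ell(v)$ and $w\preceq_t v$. Put $\mathrm{Anc}(v)=\{w\in V(G): w\preceq v\}$ and $\mathrm{Desc}(w)=\{x\in V(G): w\preceq x\}$. For a vertex $w$ and $v,u\in\mathrm{Desc}(w)$, $d_G^w(v,u)$ is the distance between $v$ and $u$ in the subgraph $G[\mathrm{Desc}(w)]$ of $G$ induced by $\mathrm{Desc}(w)$. The stable tree labelling (STL) over $T$ is $L=\{L(v): v\in V(G)\}$ with $L(v)=[\delta_{vw_1},\dots,\delta_{vw_k}]$, where $\mathrm{Anc}(v)=\{w_1,\dots,w_k\}$, $w_1\preceq\dots\preceq w_k$, and $\delta_{vw_i}=d_G^{w_i}(v,w_i)$. -}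

module Defs where

open import Algebra.Bundles using (CommutativeRing)
import Algebra.Definitions.RawMonoid as RawMonoidDefs
open import Data.Fin.Base using (Fin)
open import Data.List.Base using (List; []; _∷_; allFin; filter; length; zip)
open import Data.List.Membership.Propositional using (_∈_)
open import Data.List.Relation.Binary.Pointwise using (Pointwise)
open import Data.List.Relation.Unary.Linked using (Linked)
open import Data.List.Relation.Unary.Unique.Propositional using (Unique)
open import Data.Maybe.Base using (Maybe; just; nothing)
open import Data.Nat.Base using (ℕ)
open import Data.Irrelevant using ([_])
open import Data.Product.Base using (∃-syntax; Σ-syntax; _×_; _,_)
open import Data.Refinement using (Refinement; value) renaming (_,_ to _,ᵣ_)
open import Data.Sum.Base using (_⊎_; inj₂)
open import Function.Bundles using (_⇔_)
open import Function.Definitions using (Surjective)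
open import Level using (Level; Lift; 0ℓ; suc; _⊔_)
open import Relation.Binary.Construct.Closure.ReflexiveTransitive
  using (Star; ε; _◅_)
open import Relation.Binary.Core using (Rel)
open import Relation.Binary.Definitions using (Decidable; Symmetric)
open import Relation.Binary.PropositionalEquality.Core using (_≡_; _≢_; refl)
open import Relation.Binary.Structures using (IsTotalOrder)
open import Relation.Nullary.Construct.Add.Supremum using (_⁺; ⊤⁺)
  renaming ([_] to fin)
open import Relation.Nullary.Decidable.Core using (yes; no; map′)
open import Relation.Nullary.Negation.Core using (¬_)
open import Relation.Unary using (Pred)

-- The real numbers enter only through their structure of a totally
-- ordered field.  Everything below is parametrised by an arbitrary such
-- field; completeness and the Archimedean property are not assumed.

record OrderedField c ℓ₁ ℓ₂ : Set (suc (c ⊔ ℓ₁ ⊔ ℓ₂)) where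
  infix 4 _≤_ _<_
  field
    commutativeRing : CommutativeRing c ℓ₁
  open CommutativeRing commutativeRing public
  field
    _≤_          : Rel Carrier ℓ₂
    isTotalOrder : IsTotalOrder _≈_ _≤_
    +-monoˡ-≤    : ∀ {x y} z → x ≤ y → (x + z) ≤ (y + z)
    *-nonneg     : ∀ {x y} → 0# ≤ x → 0# ≤ y → 0# ≤ (x * y)
    0≉1          : ¬ (0# ≈ 1#)
    inverse      : ∀ x → ¬ (x ≈ 0#) → ∃[ y ] (x * y) ≈ 1#

  _<_ : Rel Carrier (ℓ₁ ⊔ ℓ₂)
  x < y = x ≤ y × ¬ (x ≈ y)

  fromℕ : ℕ → Carrier
  fromℕ k = k ×′ 1#
    where open RawMonoidDefs +-rawMonoid using () renaming (_×_ to _×′_)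

module _ {c ℓ₁ ℓ₂ : Level} (R : OrderedField c ℓ₁ ℓ₂) where

  open OrderedField R

  -- Weights are given on all pairs of vertices, but only the values on
  -- edges are constrained or used.

  record WeightedGraph {v : Level} (V : Set v) : Set (suc 0ℓ ⊔ v ⊔ c ⊔ ℓ₁ ⊔ ℓ₂) where
    infix 4 _~_ _~?_
    field
      _~_      : Rel V 0ℓ
      _~?_     : Decidable _~_
      ~-sym    : Symmetric _~_
      φ        : V → V → Carrier
      φ-sym    : ∀ {x y} → x ~ y → φ x y ≈ φ y x
      φ-nonneg : ∀ {x y} → x ~ y → 0# ≤ φ x y

  RoadNetwork : ℕ → Set (suc 0ℓ ⊔ c ⊔ ℓ₁ ⊔ ℓ₂)
  RoadNetwork n = WeightedGraph (Fin n)

  -- Weights extended by ∞, which is written ⊤⁺.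

  Distance : Set c
  Distance = Carrier ⁺

module _ {c ℓ₁ ℓ₂ : Level} {R : OrderedField c ℓ₁ ℓ₂} where

  open OrderedField R

  infixl 6 _+∞_

  _+∞_ : Distance R → Distance R → Distance R
  fin x +∞ fin y = fin (x + y)
  fin x +∞ ⊤⁺    = ⊤⁺
  ⊤⁺    +∞ _     = ⊤⁺

  module _ {v : Level} {V : Set v} (G : WeightedGraph R V) where

    open WeightedGraph G

    Path : V → V → Set v
    Path = Star _~_

    weight : ∀ {s t} → Path s t → Carrier
    weight ε                 = 0#
    weight (_◅_ {x} {y} _ p) = φ x y + weight p

    vertices : ∀ {s t} → Path s t → List V
    vertices {s} ε       = s ∷ []
    vertices {s} (_ ◅ p) = s ∷ vertices p

    IsShortest : ∀ {s t} → Path s t → Set (v ⊔ ℓ₂)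
    IsShortest {s} {t} p = (q : Path s t) → weight p ≤ weight q

    -- IsDistance s t d means d = d_G(s,t).  A finite distance is the weight
    -- of a shortest path, hence determined up to _≈_ only.

    IsDistance : V → V → Distance R → Set (v ⊔ ℓ₁ ⊔ ℓ₂)
    IsDistance s t (fin d) = Σ[ p ∈ Path s t ] IsShortest p × weight p ≈ d
    IsDistance s t ⊤⁺      = Lift (ℓ₁ ⊔ ℓ₂) (¬ Path s t)

    -- G[P].  Membership proofs in the vertex set of an induced subgraph are
    -- irrelevant, so a vertex of G gives at most one vertex of it.

    Induced : ∀ {p} (P : Pred V p) → WeightedGraph R (Refinement V P)
    Induced P = record
      { _~_      = λ x y → value x ~ value y
      ; _~?_     = λ x y → value x ~? value y
      ; ~-sym    = ~-sym
      ; φ        = λ x y → φ (value x) (value y)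
      ; φ-sym    = φ-sym
      ; φ-nonneg = φ-nonneg
      }

-- Rooted binary trees: each node has at most one left and at most one
-- right child.  The nodes of a tree are its positions.

data BinaryTree : Set where
  node : (l r : Maybe BinaryTree) → BinaryTree

data Node : BinaryTree → Set where
  root : ∀ {t} → Node t
  inˡ  : ∀ {l r} → Node l → Node (node (just l) r)
  inʳ  : ∀ {l r} → Node r → Node (node l (just r))

-- HasLeftChild N M: M is the left child of N.

data HasLeftChild : ∀ {t} → Node t → Node t → Set where
  root : ∀ {l r} → HasLeftChild {node (just l) r} root (inˡ root)
  inˡ  : ∀ {l r} {N M : Node l} → HasLeftChild N M →
         HasLeftChild {node (just l) r} (inˡ N) (inˡ M)
  inʳ  : ∀ {l r} {N M : Node r} → HasLeftChild N M →
         HasLeftChild {node l (just r)} (inʳ N) (inʳ M)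

data HasRightChild : ∀ {t} → Node t → Node t → Set where
  root : ∀ {l r} → HasRightChild {node l (just r)} root (inʳ root)
  inˡ  : ∀ {l r} {N M : Node l} → HasRightChild N M →
         HasRightChild {node (just l) r} (inˡ N) (inˡ M)
  inʳ  : ∀ {l r} {N M : Node r} → HasRightChild N M →
         HasRightChild {node l (just r)} (inʳ N) (inʳ M)

-- M ⊑ N: M is an ancestor of N or N itself.

infix 4 _⊑_ _⊏_ _⊑?_

data _⊑_ : ∀ {t} → Node t → Node t → Set where
  root : ∀ {t} {N : Node t} → root ⊑ N
  inˡ  : ∀ {l r} {M N : Node l} → M ⊑ N → _⊑_ {node (just l) r} (inˡ M) (inˡ N)
  inʳ  : ∀ {l r} {M N : Node r} → M ⊑ N → _⊑_ {node l (just r)} (inʳ M) (inʳ N)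

_⊏_ : ∀ {t} → Node t → Node t → Set
M ⊏ N = M ⊑ N × M ≢ N

_⊑?_ : ∀ {t} → Decidable (_⊑_ {t})
root  ⊑? _     = yes root
inˡ M ⊑? root  = no λ ()
inˡ M ⊑? inˡ N = map′ inˡ (λ { (inˡ p) → p }) (M ⊑? N)
inˡ M ⊑? inʳ N = no λ ()
inʳ M ⊑? root  = no λ ()
inʳ M ⊑? inˡ N = no λ ()
inʳ M ⊑? inʳ N = map′ inʳ (λ { (inʳ p) → p }) (M ⊑? N)

-- The number |T↓(N)| of graph vertices mapped into the subtree at N.

subtreeSize : ∀ {n t} → (Fin n → Node t) → Node t → ℕ
subtreeSize {n} ℓ N = length (filter (λ v → N ⊑? ℓ v) (allFin n))

module _ {c ℓ₁ ℓ₂ : Level} {R : OrderedField c ℓ₁ ℓ₂} where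

  open OrderedField R hiding (refl)

  record StableTreeHierarchy {n} (G : RoadNetwork R n) : Set (c ⊔ ℓ₁ ⊔ ℓ₂) where
    field
      tree         : BinaryTree
      ℓ            : Fin n → Node tree
      ℓ-surjective : Surjective _≡_ _≡_ ℓ

    size : Node tree → Carrier
    size N = fromℕ (subtreeSize ℓ N)

    -- x ∈ Ca(s,t)
    CommonAncestor : (s t x : Fin n) → Set
    CommonAncestor s t x = ℓ x ⊑ ℓ s × ℓ x ⊑ ℓ t

    -- The bound on sizes is required at nodes having both children.

    field
      β          : Carrier
      0<β        : 0# < β
      β≤½        : fromℕ 2 * β ≤ 1#
      balanced   : ∀ {N Nₗ Nᵣ} → HasLeftChild N Nₗ → HasRightChild N Nᵣ →
                   (size Nₗ ≤ (1# - β) * size N) × (size Nᵣ ≤ (1# - β) * size N)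
      separating : ∀ {s t} (p : Path G s t) → IsShortest G p →
                   ∃[ x ] (x ∈ vertices G p × CommonAncestor s t x)

  module _ {n} {G : RoadNetwork R n} (T : StableTreeHierarchy G)
           {o : Level} {_≤ₜ_ : Rel (Fin n) o} (≤ₜ-total : IsTotalOrder _≡_ _≤ₜ_) where

    open StableTreeHierarchy T using (ℓ)

    infix 4 _≼_

    _≼_ : Rel (Fin n) o
    w ≼ v = ℓ w ⊏ ℓ v ⊎ (ℓ w ≡ ℓ v × w ≤ₜ v)

    Anc : Fin n → Pred (Fin n) o
    Anc v w = w ≼ v

    Desc : Fin n → Pred (Fin n) o
    Desc w x = w ≼ x

    -- IsDistanceIn w v∈ u∈ d means d = d_G^w(v,u).

    IsDistanceIn : ∀ w {v u} → Desc w v → Desc w u → Distance R → Set (o ⊔ ℓ₁ ⊔ ℓ₂)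
    IsDistanceIn w {v} {u} v∈ u∈ =
      IsDistance (Induced G (Desc w)) (v ,ᵣ [ v∈ ]) (u ,ᵣ [ u∈ ])

    w∈Desc[w] : ∀ w → Desc w w
    w∈Desc[w] w = inj₂ (refl , IsTotalOrder.refl ≤ₜ-total)

    -- IsEntry v w d means w ∈ Anc(v) and d = δ_vw.

    IsEntry : (v w : Fin n) → Distance R → Set (o ⊔ ℓ₁ ⊔ ℓ₂)
    IsEntry v w d = Σ[ w∈ ∈ Anc v w ] IsDistanceIn w w∈ (w∈Desc[w] w) d

    -- anc v is the (unique) enumeration w₁ ≼ … ≼ wₖ of Anc(v) without
    -- repetition, and L v is the list [ δ_vw₁ , … , δ_vwₖ ].

    record StableTreeLabelling : Set (c ⊔ o ⊔ ℓ₁ ⊔ ℓ₂) where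
      field
        anc          : Fin n → List (Fin n)
        anc-sorted   : ∀ v → Linked _≼_ (anc v)
        anc-unique   : ∀ v → Unique (anc v)
        anc-complete : ∀ v w → w ∈ anc v ⇔ Anc v w
        L            : Fin n → List (Distance R)
        L-entries    : ∀ v → Pointwise (IsEntry v) (anc v) (L v)

      -- d is the entry δ_vwᵢ ∈ L(v) at the position i with wᵢ = w.

      EntryOf : (v w : Fin n) → Distance R → Set c
      EntryOf v w d = (w , d) ∈ zip (anc v) (L v)

{-# OPTIONS --safe #-}

-- On every shortest path p there is a vertex r with r ≼ x for all x on p: if
-- r′ is such a vertex for the path without its first vertex s, then p meets a
-- common ancestor of s and r′ between s and r′, which forces ℓ s and ℓ r′ to
-- be comparable, and the smaller of s and r′ works for p.  Hence p lies in
-- G[Desc(r)], and both of its parts at r compete with the paths realising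
-- δ_sr and δ_tr.  If s and t are not connected, the least vertex at the root
-- of the tree serves as r, and one of the two entries is ∞.

module Submission where

open import Defs
open import Algebra.Properties.Group using (//-rightDividesʳ)
open import Data.Empty using (⊥-elim)
open import Data.Fin.Base using (Fin)
open import Data.Fin.Properties using (_≟_)
open import Data.Irrelevant using ([_])
open import Data.List.Base using (List; []; _∷_; allFin; zip)
open import Data.List.Membership.Propositional using (_∈_)
open import Data.List.Membership.Propositional.Properties using (∈-allFin)
open import Data.List.Relation.Binary.Pointwise using (Pointwise; []; _∷_)
open import Data.List.Relation.Unary.All as All using (All; []; _∷_)
open import Data.List.Relation.Unary.Any using (here; there)
open import Data.Nat.Base using (ℕ)
open import Data.Product.Base using (∃-syntax; Σ-syntax; _×_; _,_)
open import Data.Refinement using (value) renaming (_,_ to _,ᵣ_)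
open import Data.Sum.Base using (_⊎_; inj₁; inj₂; swap)
open import Function.Bundles using (Equivalence)
open import Level using (Level; lift; _⊔_)
open import Relation.Binary.Bundles using (TotalOrder)
open import Relation.Binary.Construct.Closure.ReflexiveTransitive using (ε; _◅_; _◅◅_; gmap; revApp; reverse)
open import Relation.Binary.Core using (Rel)
open import Relation.Binary.Definitions using (DecidableEquality)
open import Relation.Binary.PropositionalEquality.Core as ≡ using (_≡_; refl)
open import Relation.Binary.Structures using (IsTotalOrder)
open import Relation.Nullary.Construct.Add.Supremum using (⊤⁺) renaming ([_] to fin)
open import Relation.Nullary.Decidable.Core using (yes; no)
open import Relation.Nullary.Negation.Core using (¬_)
open import Relation.Unary using (Pred)
import Relation.Binary.Reasoning.PartialOrder as PosetReasoning

-- Order arithmetic in an ordered field.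

module OrderedFieldProperties {c ℓ₁ ℓ₂ : Level} (R : OrderedField c ℓ₁ ℓ₂) where

  open OrderedField R hiding (refl)

  ≤-totalOrder : TotalOrder c ℓ₁ ℓ₂
  ≤-totalOrder = record { isTotalOrder = isTotalOrder }

  open TotalOrder ≤-totalOrder public using (poset)
    renaming (refl to ≤-refl; reflexive to ≤-reflexive; trans to ≤-trans; total to ≤-total)
  open PosetReasoning poset

  +-monoʳ-≤ : ∀ {x y} z → x ≤ y → z + x ≤ z + y
  +-monoʳ-≤ {x} {y} z x≤y = begin
    z + x ≈⟨ +-comm z x ⟩
    x + z ≤⟨ +-monoˡ-≤ z x≤y ⟩
    y + z ≈⟨ +-comm y z ⟩
    z + y ∎

  +-mono-≤ : ∀ {x y u v} → x ≤ y → u ≤ v → x + u ≤ y + v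
  +-mono-≤ {y = y} {u = u} x≤y u≤v = ≤-trans (+-monoˡ-≤ u x≤y) (+-monoʳ-≤ y u≤v)

  +-cancelʳ-≤ : ∀ {x y} z → x + z ≤ y + z → x ≤ y
  +-cancelʳ-≤ {x} {y} z x+z≤y+z = begin
    x             ≈⟨ //-rightDividesʳ +-group z x ⟨
    (x + z) - z   ≤⟨ +-monoˡ-≤ (- z) x+z≤y+z ⟩
    (y + z) - z   ≈⟨ //-rightDividesʳ +-group z y ⟩
    y             ∎

  +-cancelˡ-≤ : ∀ {x y} z → z + x ≤ z + y → x ≤ y
  +-cancelˡ-≤ {x} {y} z z+x≤z+y = +-cancelʳ-≤ z (begin
    x + z ≈⟨ +-comm x z ⟩
    z + x ≤⟨ z+x≤z+y ⟩
    z + y ≈⟨ +-comm z y ⟩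
    y + z ∎)

  x≤x+y : ∀ {x y} → 0# ≤ y → x ≤ x + y
  x≤x+y {x} {y} 0≤y = begin
    x      ≈⟨ +-identityʳ x ⟨
    x + 0# ≤⟨ +-monoʳ-≤ x 0≤y ⟩
    x + y  ∎

  x≤y+x : ∀ {x y} → 0# ≤ y → x ≤ y + x
  x≤y+x {x} {y} 0≤y = ≤-trans (x≤x+y 0≤y) (≤-reflexive (+-comm x y))

-- Paths and their weights in a weighted graph.

module _ {c ℓ₁ ℓ₂ : Level} {R : OrderedField c ℓ₁ ℓ₂} {v : Level} {V : Set v}
         (G : WeightedGraph R V) where

  open OrderedField R hiding (refl)
  open OrderedFieldProperties R
  open WeightedGraph G
  open PosetReasoning poset

  weight-◅◅ : ∀ {s r t} (p : Path G s r) (q : Path G r t) →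
              weight G (p ◅◅ q) ≈ weight G p + weight G q
  weight-◅◅ ε       q = sym (+-identityˡ _)
  weight-◅◅ (_ ◅ p) q = trans (+-congˡ (weight-◅◅ p q)) (sym (+-assoc _ _ _))

  -- `reverse` is `revApp` with the empty path as accumulator, so the induction has to run over an
  -- arbitrary accumulator `q`.
  weight-revApp : ∀ {s r t} (p : Path G r s) (q : Path G r t) →
                  weight G (revApp ~-sym p q) ≈ weight G p + weight G q
  weight-revApp ε q = sym (+-identityˡ _)
  weight-revApp (_◅_ {x} {y} e p) q = begin-equality
    weight G (revApp ~-sym p (~-sym e ◅ q)) ≈⟨ weight-revApp p (~-sym e ◅ q) ⟩
    weight G p + (φ y x + weight G q)       ≈⟨ +-assoc _ _ _ ⟨
    (weight G p + φ y x) + weight G q       ≈⟨ +-congʳ (+-comm _ _) ⟩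
    (φ y x + weight G p) + weight G q       ≈⟨ +-congʳ (+-congʳ (φ-sym e)) ⟨
    (φ x y + weight G p) + weight G q       ∎

  weight-reverse : ∀ {s t} (p : Path G s t) → weight G (reverse ~-sym p) ≈ weight G p
  weight-reverse p = trans (weight-revApp p ε) (+-identityʳ _)

  target∈vertices : ∀ {s t} (p : Path G s t) → t ∈ vertices G p
  target∈vertices ε       = here refl
  target∈vertices (_ ◅ p) = there (target∈vertices p)

  source∈vertices : ∀ {s t} (p : Path G s t) → s ∈ vertices G p
  source∈vertices ε       = here refl
  source∈vertices (_ ◅ _) = here refl

  ∈-vertices-◅◅ˡ : ∀ {s r t x} (p : Path G s r) (q : Path G r t) →
                   x ∈ vertices G p → x ∈ vertices G (p ◅◅ q)
  ∈-vertices-◅◅ˡ ε       q (here refl) = source∈vertices q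
  ∈-vertices-◅◅ˡ (_ ◅ p) q (here refl) = here refl
  ∈-vertices-◅◅ˡ (_ ◅ p) q (there x∈p) = there (∈-vertices-◅◅ˡ p q x∈p)

  ∈-vertices-◅◅ʳ : ∀ {s r t x} (p : Path G s r) (q : Path G r t) →
                   x ∈ vertices G q → x ∈ vertices G (p ◅◅ q)
  ∈-vertices-◅◅ʳ ε       q x∈q = x∈q
  ∈-vertices-◅◅ʳ (_ ◅ p) q x∈q = there (∈-vertices-◅◅ʳ p q x∈q)

  split : ∀ {s r t} (p : Path G s t) → r ∈ vertices G p →
          Σ[ p₁ ∈ Path G s r ] Σ[ p₂ ∈ Path G r t ] p ≡ p₁ ◅◅ p₂
  split ε       (here refl) = ε , ε , refl
  split (e ◅ p) (here refl) = ε , e ◅ p , refl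
  split (e ◅ p) (there r∈p) with split p r∈p
  ... | p₁ , p₂ , refl = e ◅ p₁ , p₂ , refl

  shortest-tail : ∀ {s y t} (e : s ~ y) (p : Path G y t) → IsShortest G (e ◅ p) → IsShortest G p
  shortest-tail e p sh q = +-cancelˡ-≤ _ (sh (e ◅ q))

  shortest-prefix : ∀ {s r t} (p : Path G s r) (q : Path G r t) →
                    IsShortest G (p ◅◅ q) → IsShortest G p
  shortest-prefix p q sh p′ = +-cancelʳ-≤ (weight G q) (begin
    weight G p + weight G q  ≈⟨ weight-◅◅ p q ⟨
    weight G (p ◅◅ q)        ≤⟨ sh (p′ ◅◅ q) ⟩
    weight G (p′ ◅◅ q)       ≈⟨ weight-◅◅ p′ q ⟩
    weight G p′ + weight G q ∎)

  -- Transfer of paths between a graph and an induced subgraph.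

  module _ {p : Level} {P : Pred V p} where

    embed : ∀ {x y} → Path (Induced G P) x y → Path G (value x) (value y)
    embed = gmap value (λ e → e)

    weight-embed : ∀ {x y} (q : Path (Induced G P) x y) →
                   weight G (embed q) ≡ weight (Induced G P) q
    weight-embed ε       = refl
    weight-embed (_ ◅ q) = ≡.cong (_ +_) (weight-embed q)

    -- In the `ε` case `s∈` and `t∈` may be different proofs; irrelevance identifies the two
    -- vertices. The tail is split once more so that `vertices` exposes its head, and with it the
    -- membership proof of the next vertex.
    restrict : ∀ {s t} (q : Path G s t) → All P (vertices G q) → (s∈ : P s) (t∈ : P t) →
               Path (Induced G P) (s ,ᵣ [ s∈ ]) (t ,ᵣ [ t∈ ])
    restrict ε             _                 _ _  = ε
    restrict (e ◅ ε)       _                 _ _  = e ◅ ε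
    restrict (e ◅ (f ◅ q)) (_ ∷ ps@(y∈ ∷ _)) _ t∈ = e ◅ restrict (f ◅ q) ps y∈ t∈

    weight-restrict : ∀ {s t} (q : Path G s t) (ps : All P (vertices G q)) (s∈ : P s) (t∈ : P t) →
                      weight (Induced G P) (restrict q ps s∈ t∈) ≡ weight G q
    weight-restrict ε             _                 _ _  = refl
    weight-restrict (_ ◅ ε)       _                 _ _  = refl
    weight-restrict (_ ◅ (f ◅ q)) (_ ∷ ps@(y∈ ∷ _)) _ t∈ = ≡.cong (_ +_) (weight-restrict (f ◅ q) ps y∈ t∈)

  -- Deciding between a shortest path and no path at all.

  -- The Floyd–Warshall recursion on lengths, xs being the admitted interior
  -- vertices.  As weights are nonnegative, at most one detour through each k
  -- suffices, which makes walk-trans provable without removing cycles.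

  data Walk : List V → V → V → Carrier → Set (v ⊔ c ⊔ ℓ₂) where
    empty : ∀ {s} → Walk [] s s 0#
    edge  : ∀ {s t} → s ~ t → Walk [] s t (φ s t)
    skip  : ∀ {k xs s t x} → Walk xs s t x → Walk (k ∷ xs) s t x
    via   : ∀ {k xs s t a b x} → Walk xs s k a → Walk xs k t b → a + b ≤ x → Walk (k ∷ xs) s t x

  walk-nonneg : ∀ {xs s t x} → Walk xs s t x → 0# ≤ x
  walk-nonneg empty           = ≤-refl
  walk-nonneg (edge e)        = φ-nonneg e
  walk-nonneg (skip w)        = walk-nonneg w
  walk-nonneg (via u w a+b≤x) = ≤-trans (≤-trans (walk-nonneg u) (x≤x+y (walk-nonneg w))) a+b≤x

  walk-refl : ∀ xs {s} → Walk xs s s 0#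
  walk-refl []       = empty
  walk-refl (_ ∷ xs) = skip (walk-refl xs)

  walk-edge : ∀ xs {s t} → s ~ t → Walk xs s t (φ s t)
  walk-edge []       e = edge e
  walk-edge (_ ∷ xs) e = skip (walk-edge xs e)

  walk-trans : ∀ {xs s y t a b} → y ∈ xs → Walk xs s y a → Walk xs y t b → Walk xs s t (a + b)
  walk-trans (here refl) (skip u)      (skip w)      = via u w ≤-refl
  walk-trans (here refl) (skip u)      (via w w′ le) =
    via u w′ (+-monoʳ-≤ _ (≤-trans (x≤y+x (walk-nonneg w)) le))
  walk-trans (here refl) (via u u′ le) (skip w)      =
    via u w (+-monoˡ-≤ _ (≤-trans (x≤x+y (walk-nonneg u′)) le))
  walk-trans (there y∈)  (skip u)      (skip w)      = skip (walk-trans y∈ u w)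
  walk-trans (there y∈)  (skip u)      (via w w′ le) =
    via (walk-trans y∈ u w) w′ (≤-trans (≤-reflexive (+-assoc _ _ _)) (+-monoʳ-≤ _ le))
  walk-trans (there y∈)  (via u u′ le) (skip w)      =
    via u (walk-trans y∈ u′ w) (≤-trans (≤-reflexive (sym (+-assoc _ _ _))) (+-monoˡ-≤ _ le))
  walk-trans _           (via u u′ le) (via w w′ le′) =
    via u w′ (+-mono-≤ (≤-trans (x≤x+y (walk-nonneg u′)) le) (≤-trans (x≤y+x (walk-nonneg w)) le′))

  path⇒walk : ∀ {xs} → (∀ y → y ∈ xs) → ∀ {s t} (p : Path G s t) → Walk xs s t (weight G p)
  path⇒walk {xs} all ε       = walk-refl xs
  path⇒walk {xs} all (e ◅ p) = walk-trans (all _) (walk-edge xs e) (path⇒walk all p)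

  Dominated : (s t : V) → Pred Carrier (v ⊔ c ⊔ ℓ₂) → Set (v ⊔ c ⊔ ℓ₂)
  Dominated s t P = (Σ[ p ∈ Path G s t ] ∀ {x} → P x → weight G p ≤ x) ⊎ (∀ {x} → ¬ P x)

  -- A best walk from `s` to `t` either avoids `k` or joins best walks from `s` to `k` and from `k`
  -- to `t`; each case tells which candidates exist, and `≤-total` picks the lighter when there are
  -- two.
  walk-dominated : DecidableEquality V → ∀ xs s t → Dominated s t (Walk xs s t)
  walk-dominated _≟_ [] s t with s ≟ t
  -- A loop at `s` is also a walk here, so the empty path wins by nonnegativity of weights.
  ... | yes refl = inj₁ (ε , walk-nonneg)
  ... | no s≢t with s ~? t
  ...   | no ¬e = inj₂ λ { empty → s≢t refl ; (edge e) → ¬e e }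
  ...   | yes e = inj₁ (e ◅ ε , λ { empty → ⊥-elim (s≢t refl) ; (edge _) → ≤-reflexive (+-identityʳ _) })
  walk-dominated _≟_ (k ∷ xs) s t
    with walk-dominated _≟_ xs s t | walk-dominated _≟_ xs s k | walk-dominated _≟_ xs k t
  ... | inj₂ none      | inj₂ none′     | _               =
    inj₂ λ { (skip w) → none w ; (via u _ _) → none′ u }
  ... | inj₂ none      | inj₁ _         | inj₂ none′      =
    inj₂ λ { (skip w) → none w ; (via _ u _) → none′ u }
  ... | inj₁ (p , p≤)  | inj₂ none′     | _               =
    inj₁ (p , λ { (skip w) → p≤ w ; (via u _ _) → ⊥-elim (none′ u) })
  ... | inj₁ (p , p≤)  | inj₁ _         | inj₂ none′      =
    inj₁ (p , λ { (skip w) → p≤ w ; (via _ u _) → ⊥-elim (none′ u) })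
  ... | inj₂ none      | inj₁ (q , q≤)  | inj₁ (q′ , q′≤) =
    inj₁ (q ◅◅ q′ , λ { (skip w)      → ⊥-elim (none w)
                      ; (via u u′ le) → ≤-trans (≤-reflexive (weight-◅◅ q q′))
                                                (≤-trans (+-mono-≤ (q≤ u) (q′≤ u′)) le) })
  ... | inj₁ (p , p≤)  | inj₁ (q , q≤)  | inj₁ (q′ , q′≤)
    with ≤-total (weight G p) (weight G (q ◅◅ q′))
  ...   | inj₁ p≤qq′ =
    inj₁ (p , λ { (skip w)      → p≤ w
                ; (via u u′ le) → ≤-trans p≤qq′ (≤-trans (≤-reflexive (weight-◅◅ q q′))
                                                         (≤-trans (+-mono-≤ (q≤ u) (q′≤ u′)) le)) })
  ...   | inj₂ qq′≤p =
    inj₁ (q ◅◅ q′ , λ { (skip w)      → ≤-trans qq′≤p (p≤ w)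
                      ; (via u u′ le) → ≤-trans (≤-reflexive (weight-◅◅ q q′))
                                                (≤-trans (+-mono-≤ (q≤ u) (q′≤ u′)) le) })

  -- Once `xs` lists every vertex, the weight of each path is the length of a walk, so a bound on
  -- walks is a bound on paths.
  shortestPath : DecidableEquality V → ∀ {xs} → (∀ y → y ∈ xs) → ∀ s t →
                 (Σ[ p ∈ Path G s t ] IsShortest G p) ⊎ (¬ Path G s t)
  shortestPath _≟_ {xs} all s t with walk-dominated _≟_ xs s t
  ... | inj₁ (p , p≤) = inj₁ (p , λ q → p≤ (path⇒walk all q))
  ... | inj₂ none     = inj₂ λ p → none (path⇒walk all p)

-- The ancestor order on tree nodes.

⊑-refl : ∀ {t} {N : Node t} → N ⊑ N
⊑-refl {N = root}  = root
⊑-refl {N = inˡ N} = inˡ ⊑-refl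
⊑-refl {N = inʳ N} = inʳ ⊑-refl

⊑-reflexive : ∀ {t} {M N : Node t} → M ≡ N → M ⊑ N
⊑-reflexive refl = ⊑-refl

⊑-trans : ∀ {t} {L M N : Node t} → L ⊑ M → M ⊑ N → L ⊑ N
⊑-trans root    _       = root
⊑-trans (inˡ p) (inˡ q) = inˡ (⊑-trans p q)
⊑-trans (inʳ p) (inʳ q) = inʳ (⊑-trans p q)

⊑-antisym : ∀ {t} {M N : Node t} → M ⊑ N → N ⊑ M → M ≡ N
⊑-antisym root    root    = refl
⊑-antisym (inˡ p) (inˡ q) = ≡.cong inˡ (⊑-antisym p q)
⊑-antisym (inʳ p) (inʳ q) = ≡.cong inʳ (⊑-antisym p q)

-- Given `M ⊑ N`, testing `N ⊑ M` decides equality of nodes, by antisymmetry.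
⊑⇒⊏⊎≡ : ∀ {t} {M N : Node t} → M ⊑ N → M ⊏ N ⊎ M ≡ N
⊑⇒⊏⊎≡ {M = M} {N} M⊑N with N ⊑? M
... | yes N⊑M = inj₂ (⊑-antisym M⊑N N⊑M)
... | no  N⋢M = inj₁ (M⊑N , λ { refl → N⋢M ⊑-refl })

-- The vertex order and its least elements on shortest paths.

module _ {c ℓ₁ ℓ₂ o : Level} {R : OrderedField c ℓ₁ ℓ₂} {n : ℕ} {G : RoadNetwork R n}
         (T : StableTreeHierarchy G)
         {_≤ₜ_ : Rel (Fin n) o} (≤ₜ-total : IsTotalOrder _≡_ _≤ₜ_) where

  open OrderedField R using (_+_; +-cong)
    renaming (_≈_ to _≈ᴿ_; trans to ≈-trans)
  open OrderedFieldProperties R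
  open StableTreeHierarchy T
  module ≤ₜ = IsTotalOrder ≤ₜ-total
  open PosetReasoning poset

  infix 4 _≼ᵀ_

  _≼ᵀ_ : Rel (Fin n) o
  _≼ᵀ_ = _≼_ T ≤ₜ-total

  ≼⇒⊑ : ∀ {w v} → w ≼ᵀ v → ℓ w ⊑ ℓ v
  ≼⇒⊑ (inj₁ (w⊑v , _)) = w⊑v
  ≼⇒⊑ (inj₂ (w≡v , _)) = ⊑-reflexive w≡v

  -- If `ℓ u` and `ℓ w` coincide, `ℓ v` is squeezed between them, so no step was strict and `≤ₜ`
  -- decides.
  ≼-trans : ∀ {u v w} → u ≼ᵀ v → v ≼ᵀ w → u ≼ᵀ w
  ≼-trans {u} {v} {w} u≼v v≼w with ⊑⇒⊏⊎≡ (⊑-trans (≼⇒⊑ u≼v) (≼⇒⊑ v≼w))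
  ... | inj₁ u⊏w = inj₁ u⊏w
  ≼-trans (inj₁ (u⊑v , u≢v)) v≼w | inj₂ u≡w =
    ⊥-elim (u≢v (⊑-antisym u⊑v (⊑-trans (≼⇒⊑ v≼w) (⊑-reflexive (≡.sym u≡w)))))
  ≼-trans (inj₂ (u≡v , _)) (inj₁ (_ , v≢w)) | inj₂ u≡w =
    ⊥-elim (v≢w (≡.trans (≡.sym u≡v) u≡w))
  ≼-trans (inj₂ (_ , u≤v)) (inj₂ (_ , v≤w)) | inj₂ u≡w = inj₂ (u≡w , ≤ₜ.trans u≤v v≤w)

  ⊑⇒≼⊎≽ : ∀ {u v} → ℓ u ⊑ ℓ v → u ≼ᵀ v ⊎ v ≼ᵀ u
  ⊑⇒≼⊎≽ {u} {v} u⊑v with ⊑⇒⊏⊎≡ u⊑v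
  ... | inj₁ u⊏v = inj₁ (inj₁ u⊏v)
  ... | inj₂ u≡v with ≤ₜ.total u v
  ...   | inj₁ u≤v = inj₁ (inj₂ (u≡v , u≤v))
  ...   | inj₂ v≤u = inj₂ (inj₂ (≡.sym u≡v , v≤u))

  ≼-refl : ∀ {v} → v ≼ᵀ v
  ≼-refl = w∈Desc[w] T ≤ₜ-total _

  ≼-extend : ∀ {s r} {xs : List (Fin n)} → s ≼ᵀ r ⊎ r ≼ᵀ s → All (r ≼ᵀ_) xs → r ∈ xs →
             ∃[ r′ ] (r′ ∈ s ∷ xs × All (r′ ≼ᵀ_) (s ∷ xs))
  ≼-extend {s} (inj₁ s≼r) r≼ r∈ = s , here refl , ≼-refl ∷ All.map (≼-trans s≼r) r≼
  ≼-extend {s} {r} (inj₂ r≼s) r≼ r∈ = r , there r∈ , r≼s ∷ r≼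

  shortest⇒least : ∀ {s t} (p : Path G s t) → IsShortest G p →
                   ∃[ r ] (r ∈ vertices G p × All (r ≼ᵀ_) (vertices G p))
  shortest⇒least {s} ε _ = s , here refl , ≼-refl ∷ []
  shortest⇒least {s} (e ◅ p) sh with shortest⇒least p (shortest-tail G e p sh)
  ... | r , r∈p , r≼p with split G p r∈p
  -- Separation is applied to the prefix ending at `r`, so that it yields a common ancestor of `s`
  -- and `r`.
  ...   | p₁ , p₂ , refl with separating (e ◅ p₁) (shortest-prefix G (e ◅ p₁) p₂ sh)
  ...     | _ , here refl , _ , s⊑r = ≼-extend (⊑⇒≼⊎≽ s⊑r) r≼p r∈p
  -- Here `x` lies on the tail, where `r` is least, so `ℓ r ⊑ ℓ x ⊑ ℓ s`.
  ...     | _ , there x∈p₁ , x⊑s , _ = ≼-extend (swap (⊑⇒≼⊎≽ r⊑s)) r≼p r∈p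
    where r⊑s = ⊑-trans (≼⇒⊑ (All.lookup r≼p (∈-vertices-◅◅ˡ G p₁ p₂ x∈p₁))) x⊑s

  -- Surjectivity of `ℓ` supplies a first vertex at the root. Staying at the root keeps the
  -- candidate comparable with each new `x`, and an `x` that precedes it must lie at the root too.
  least-at-root : (xs : List (Fin n)) → ∃[ r ] (ℓ r ≡ root × All (r ≼ᵀ_) xs)
  least-at-root [] = let r , ℓr≡ = ℓ-surjective root in r , ℓr≡ refl , []
  least-at-root (x ∷ xs) with least-at-root xs
  ... | r , ℓr≡root , r≼xs with ⊑⇒≼⊎≽ {r} {x} (⊑-trans (⊑-reflexive ℓr≡root) root)
  ...   | inj₁ r≼x = r , ℓr≡root , r≼x ∷ r≼xs
  ...   | inj₂ x≼r = x , ⊑-antisym (⊑-trans (≼⇒⊑ x≼r) (⊑-reflexive ℓr≡root)) root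
                       , ≼-refl ∷ All.map (≼-trans x≼r) r≼xs

  -- Distances through a common ancestor.

  module _ {s t r : Fin n} (s∈ : r ≼ᵀ s) (t∈ : r ≼ᵀ t) where

    private
      Gʳ = Induced G (Desc T ≤ₜ-total r)
      r∈ = w∈Desc[w] T ≤ₜ-total r

    -- Both entries measure distance towards `r`, hence the reversal of the second leg.
    join : Path Gʳ (s ,ᵣ [ s∈ ]) (r ,ᵣ [ r∈ ]) → Path Gʳ (t ,ᵣ [ t∈ ]) (r ,ᵣ [ r∈ ]) → Path G s t
    join q₁ q₂ = embed G q₁ ◅◅ reverse (WeightedGraph.~-sym G) (embed G q₂)

    weight-join : ∀ q₁ q₂ → weight G (join q₁ q₂) ≈ᴿ weight Gʳ q₁ + weight Gʳ q₂
    weight-join q₁ q₂ = ≈-trans (weight-◅◅ G (embed G q₁) _)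
      (+-cong (OrderedField.reflexive R (weight-embed G q₁))
              (≈-trans (weight-reverse G (embed G q₂)) (OrderedField.reflexive R (weight-embed G q₂))))

    -- Two finite entries would join to a path from `s` to `t`; otherwise the sum is `⊤⁺`.
    distance-disconnected : ∀ {d₁ d₂} → ¬ Path G s t →
      IsDistanceIn T ≤ₜ-total r s∈ r∈ d₁ → IsDistanceIn T ≤ₜ-total r t∈ r∈ d₂ →
      IsDistance G s t (_+∞_ {R = R} d₁ d₂)
    distance-disconnected {fin _} {fin _} ¬p (q₁ , _) (q₂ , _) = ⊥-elim (¬p (join q₁ q₂))
    distance-disconnected {fin _} {⊤⁺}    ¬p _        _        = lift ¬p
    distance-disconnected {⊤⁺}    {_}     ¬p _        _        = lift ¬p

    distance-through : ∀ {d₁ d₂} (p₁ : Path G s r) (p₂ : Path G r t) →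
      IsShortest G (p₁ ◅◅ p₂) → All (r ≼ᵀ_) (vertices G (p₁ ◅◅ p₂)) →
      IsDistanceIn T ≤ₜ-total r s∈ r∈ d₁ → IsDistanceIn T ≤ₜ-total r t∈ r∈ d₂ →
      IsDistance G s t (_+∞_ {R = R} d₁ d₂)
    distance-through p₁ p₂ sh r≼p = go
      where
      r≼p₁ = All.tabulate λ x∈ → All.lookup r≼p (∈-vertices-◅◅ˡ G p₁ p₂ x∈)
      r≼p₂ = All.tabulate λ x∈ → All.lookup r≼p (∈-vertices-◅◅ʳ G p₁ p₂ x∈)

      p₁ʳ = restrict G p₁ r≼p₁ s∈ r∈
      p₂ʳ = restrict G p₂ r≼p₂ r∈ t∈
      p₂ʳ⁻¹ = reverse (λ {x} {y} → WeightedGraph.~-sym Gʳ {x} {y}) p₂ʳ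

      go : ∀ {d₁ d₂} → IsDistanceIn T ≤ₜ-total r s∈ r∈ d₁ → IsDistanceIn T ≤ₜ-total r t∈ r∈ d₂ →
           IsDistance G s t (_+∞_ {R = R} d₁ d₂)
      -- The two halves of the path, restricted to `Gʳ`, rule out infinite entries.
      go {⊤⁺}    {_}     (lift ¬q₁) _         = ⊥-elim (¬q₁ p₁ʳ)
      go {fin _} {⊤⁺}    _         (lift ¬q₂) = ⊥-elim (¬q₂ p₂ʳ⁻¹)
      go {fin _} {fin _} (q₁ , sh₁ , q₁≈d₁) (q₂ , sh₂ , q₂≈d₂) =
        join q₁ q₂ , shortest , ≈-trans (weight-join q₁ q₂) (+-cong q₁≈d₁ q₂≈d₂)
        where
        shortest : IsShortest G (join q₁ q₂)
        -- The joined path is no heavier than the given shortest path, hence is itself shortest in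
        -- `G`.
        shortest q = begin
          weight G (join q₁ q₂)           ≈⟨ weight-join q₁ q₂ ⟩
          weight Gʳ q₁ + weight Gʳ q₂     ≤⟨ +-mono-≤ (sh₁ p₁ʳ) (sh₂ p₂ʳ⁻¹) ⟩
          weight Gʳ p₁ʳ + weight Gʳ p₂ʳ⁻¹ ≈⟨ +-cong (OrderedField.refl R) (weight-reverse Gʳ p₂ʳ) ⟩
          weight Gʳ p₁ʳ + weight Gʳ p₂ʳ   ≡⟨ ≡.cong₂ _+_ (weight-restrict G p₁ r≼p₁ s∈ r∈)
                                                         (weight-restrict G p₂ r≼p₂ r∈ t∈) ⟩
          weight G p₁ + weight G p₂       ≈⟨ weight-◅◅ G p₁ p₂ ⟨
          weight G (p₁ ◅◅ p₂)             ≤⟨ sh q ⟩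
          weight G q                      ∎

  -- Reading entries off the labelling.

  module _ (STL : StableTreeLabelling T ≤ₜ-total) where

    open StableTreeLabelling STL

    entry : ∀ {v w} → w ≼ᵀ v → ∃[ d ] (EntryOf v w d × IsEntry T ≤ₜ-total v w d)
    entry {v} {w} w≼v = zip-lookup (L-entries v) (Equivalence.from (anc-complete v w) w≼v)
      where
      zip-lookup : ∀ {as ds} → Pointwise (IsEntry T ≤ₜ-total v) as ds → w ∈ as →
                   ∃[ d ] ((w , d) ∈ zip as ds × IsEntry T ≤ₜ-total v w d)
      zip-lookup (e ∷ _)  (here refl) = _ , here refl , e
      zip-lookup (_ ∷ es) (there w∈)  = let d , d∈ , e = zip-lookup es w∈ in d , there d∈ , e

lemma4p7 : ∀ {c ℓ₁ ℓ₂ o : Level} (R : OrderedField c ℓ₁ ℓ₂) {n : ℕ} (G : RoadNetwork R n)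
    (T : StableTreeHierarchy G)
    {_≤ₜ_ : Rel (Fin n) o} (≤ₜ-total : IsTotalOrder _≡_ _≤ₜ_)
    (STL : StableTreeLabelling T ≤ₜ-total) (let open StableTreeLabelling STL) →
    ∀ (s t : Fin n) →
    ∃[ r ] (Anc T ≤ₜ-total s r × Anc T ≤ₜ-total t r ×
    ∃[ δₛᵣ ] ∃[ δₜᵣ ] (EntryOf s r δₛᵣ × EntryOf t r δₜᵣ ×
    IsDistance G s t (_+∞_ {R = R} δₛᵣ δₜᵣ)))
lemma4p7 R {n} G T ≤ₜ-total STL s t with shortestPath G _≟_ ∈-allFin s t
lemma4p7 R {n} G T ≤ₜ-total STL s t | inj₁ (p , sh) with shortest⇒least T ≤ₜ-total p sh
... | r , r∈p , r≼p with split G p r∈p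
...   | p₁ , p₂ , refl =
  let s∈ = All.lookup r≼p (source∈vertices G p)
      t∈ = All.lookup r≼p (target∈vertices G p)
      d₁ , d₁∈ , s∈′ , δ₁ = entry T ≤ₜ-total STL s∈
      d₂ , d₂∈ , t∈′ , δ₂ = entry T ≤ₜ-total STL t∈
  in r , s∈ , t∈ , d₁ , d₂ , d₁∈ , d₂∈ , distance-through T ≤ₜ-total s∈′ t∈′ p₁ p₂ sh r≼p δ₁ δ₂
-- Taking the least of all vertices puts `r` below both `s` and `t`.
lemma4p7 R {n} G T ≤ₜ-total STL s t | inj₂ ¬p with least-at-root T ≤ₜ-total (allFin n)
... | r , _ , r≼ =
  let s∈ = All.lookup r≼ (∈-allFin s)
      t∈ = All.lookup r≼ (∈-allFin t)
      d₁ , d₁∈ , s∈′ , δ₁ = entry T ≤ₜ-total STL s∈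
      d₂ , d₂∈ , t∈′ , δ₂ = entry T ≤ₜ-total STL t∈
  in r , s∈ , t∈ , d₁ , d₂ , d₁∈ , d₂∈ , distance-disconnected T ≤ₜ-total s∈′ t∈′ ¬p δ₁ δ₂
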